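{- Let $\mathbf s$ be a nonempty finite sequence of positive integers. Then $T(\mathbf s)$ equals the number of paths from $\mathbf s$ to $(1)$ in the Hasse diagram of $\mathcal L(\mathbf s)$, i.e. the number of sequences $\mathbf s=\mathbf s^{(0)}\lessdot\mathbf s^{(1)}\lessdot\cdots\lessdot\mathbf s^{(m)}=(1)$.
   Context: A noncommutative crossing partition of $[n]=\{1,\dots,n\}$ is a finite sequence $\pi=(\pi_1,\dots,\pi_l)$ of nonempty blocks such that each $p\in[n]$ appears exactly once in $\pi$, each block is written as an increasing sequence, and $\max(\pi_i)>\min(\pi_{i+1})$ for $1\le i\le l-1$. It is of type $(s_1,\dots,s_l)$ if $\pi_i$ has $s_i$ elements for each $i$. For $\mathbf s=(s_1,\dots,s_l)$ a sequence of positive integers with sum $n$, $T(\mathbf s)$ is the number of noncommutative crossing partitions of $[n]$ of type $\mathbf s$. Define $$S_1(\mathbf s)=\{i\le l-1: s_i>1\}\cup\{l\},\qquad S_2(\mathbf s)=\{i\le l-1: s_{i+1}\ge2\}.$$ For finite nonempty sequences of positive integers, $\mathbf s\lessdot\mathbf s'$ means that either $\mathbf s'=(s_1,\dots,s_{i-1},s_i-1,s_{i+1},\dots,s_l)$ for some $i\in S_1(\mathbf s)$ (where for $i=l$ and $s_l=1$ the last entry $0$ is deleted, so $\mathbf s'=(s_1,\dots,s_{l-1})$), or $\mathbf s'=(s_1,\dots,s_{i-1},s_i+s_{i+1}-1,s_{i+2},\dots,s_l)$ for some $i\in S_2(\mathbf s)$. $\mathcal L(\mathbf s)$ is the poset generated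 by these cover relations starting from the minimum element $\mathbf s$; its greatest element is $(1)$. -}

module Defs where

open import Data.Nat.Base using (ℕ; _+_; _∸_; _≤_; _<_; _⊔_; _⊓_)
open import Data.List.Base
  using (List; []; _∷_; _++_; _∷ʳ_; [_]; length; map; concat; head; last; sum)
open import Data.List.NonEmpty.Base as List⁺ using (List⁺; toList; foldr₁)
open import Data.List.Membership.Propositional using (_∈_)
open import Data.List.Membership.Propositional.Properties.WithK using (unique∧set⇒bag)
open import Data.List.Relation.Binary.BagAndSetEquality using (∼bag⇒↭)
open import Data.List.Relation.Binary.Permutation.Propositional.Properties using (↭-length)
open import Data.List.Relation.Unary.All using (All)
open import Data.List.Relation.Unary.Linked using (Linked)
open import Data.List.Relation.Unary.Unique.Propositional using (Unique)
open import Data.Maybe.Base using (just)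
open import Data.Product.Base using (_×_; ∃-syntax; _,_)
open import Function.Base using (_∘_)
open import Function.Bundles using (_⇔_)
open import Function.Properties.Equivalence using (⇔-isEquivalence)
open import Relation.Binary.PropositionalEquality
  using (_≡_; _≢_; refl; sym; trans)
open import Relation.Binary.Structures using (module IsEquivalence)

-- Exactly k elements of A satisfy P.
HasCount : {A : Set} → (A → Set) → ℕ → Set
HasCount {A} P k =
  ∃[ xs ] Unique {A = A} xs × (∀ x → x ∈ xs ⇔ P x) × length xs ≡ k

HasCount-unique : {A : Set} {P : A → Set} {j k : ℕ} →
                  HasCount P j → HasCount P k → j ≡ k
HasCount-unique (xs , xs! , xs⇔P , refl) (ys , ys! , ys⇔P , refl) =
  ↭-length (∼bag⇒↭ (unique∧set⇒bag xs! ys! λ {x} → ⇔.trans (xs⇔P x) (⇔.sym (ys⇔P x))))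
  where module ⇔ = IsEquivalence ⇔-isEquivalence

max min : List⁺ ℕ → ℕ
max = foldr₁ _⊔_
min = foldr₁ _⊓_

-- Blocks are nonempty by their type List⁺ ℕ.
record IsCrossingPartition (n : ℕ) (π : List (List⁺ ℕ)) : Set where
  field
    increasing : All (Linked _<_ ∘ toList) π
    covers     : ∀ p → p ∈ concat (map toList π) ⇔ (1 ≤ p × p ≤ n)
    once       : Unique (concat (map toList π))
    crossing   : Linked (λ b c → min c < max b) π

HasType : List ℕ → List (List⁺ ℕ) → Set
HasType s π = map List⁺.length π ≡ s

-- T(s) = t
IsT : List ℕ → ℕ → Set
IsT s = HasCount (λ π → IsCrossingPartition (sum s) π × HasType s π)

-- The index i is given by splitting s around its i-th entry.  The first
-- three constructors are the indices of S₁(s): i ≤ l - 1 with s_i > 1, then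
-- i = l with s_l > 1, then i = l with s_l = 1, where the resulting 0 is
-- deleted and the rest has to be nonempty.  The last constructor is S₂(s).
-- On sequences of positive integers the subtractions are never truncated,
-- and the result is again a nonempty sequence of positive integers.
infix 4 _⋖_
data _⋖_ (s s′ : List ℕ) : Set where
  decrease     : ∀ xs a y ys → 1 < a →
                 s  ≡ xs ++ a ∷ y ∷ ys →
                 s′ ≡ xs ++ (a ∸ 1) ∷ y ∷ ys → s ⋖ s′
  decreaseLast : ∀ xs a → 1 < a →
                 s  ≡ xs ∷ʳ a →
                 s′ ≡ xs ∷ʳ (a ∸ 1) → s ⋖ s′
  deleteLast   : s′ ≢ [] → s ≡ s′ ∷ʳ 1 → s ⋖ s′
  merge        : ∀ xs a b ys → 2 ≤ b →
                 s  ≡ xs ++ a ∷ b ∷ ys →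
                 s′ ≡ xs ++ (a + b ∸ 1) ∷ ys → s ⋖ s′

-- ps = (s⁽⁰⁾, …, s⁽ᵐ⁾) with s = s⁽⁰⁾ ⋖ s⁽¹⁾ ⋖ ⋯ ⋖ s⁽ᵐ⁾ = (1)
record IsPath (s : List ℕ) (ps : List (List ℕ)) : Set where
  field
    starts : head ps ≡ just s
    ends   : last ps ≡ just [ 1 ]
    steps  : Linked _⋖_ ps

{-# OPTIONS --safe #-}
-- Remove the least element x from a crossing partition of type s.  If x forms
-- a block of its own, that block is the last one, as no later minimum is below
-- x.  Otherwise x leaves behind a nonempty block c; if the block b before it no
-- longer crosses c, then all of b lies below c, and b and c are merged.  Each
-- outcome is again a crossing partition, its type covers s, and the cover
-- relation tells how to put x back.  Hence T(s) is the sum of T(s′) over the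
-- covers s′ of s, which is the recurrence for the number of paths from s to (1).
module Submission where

open import Defs
open import Data.Empty using (⊥)
open import Data.List.Base
  using (List; []; _∷_; _++_; _∷ʳ_; [_]; concat; deduplicate; length; map)
open import Data.List.Membership.Propositional using (_∈_; _∉_; find; lose)
open import Data.List.Membership.Propositional.Properties
  using (∈-++⁺ˡ; ∈-++⁺ʳ; ∈-++⁻; ∈-map⁺; ∈-map⁻; ∈-deduplicate⁺; ∈-deduplicate⁻)
open import Data.List.NonEmpty.Base as List⁺
  using (List⁺; _∷_; toList; _∷⁺_; _⁺++⁺_)
open import Data.List.Properties
  using (length-++; ++-assoc; ∷-injectiveˡ; ∷-injectiveʳ; ≡-dec)
open import Data.List.Relation.Binary.Permutation.Propositional
  using (_↭_; ↭-refl; ↭-reflexive; ↭-sym; ↭-trans; ↭⇒↭ₛ; prep)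
open import Data.List.Relation.Binary.Permutation.Propositional.Properties
  using (∈-resp-↭; shift; ++⁺ˡ)
open import Data.List.Relation.Binary.Pointwise.Base using (Pointwise; []; _∷_)
open import Data.List.Relation.Unary.All as All using (All; []; _∷_)
import Data.List.Relation.Unary.All.Properties as All
open import Data.List.Relation.Unary.AllPairs using (AllPairs; []; _∷_)
import Data.List.Relation.Unary.AllPairs.Properties as AllPairs
open import Data.List.Relation.Unary.Any as Any using (Any; here; there; any?)
import Data.List.Relation.Unary.Any.Properties as Any
open import Data.List.Relation.Unary.Linked as Linked using (Linked; [-]; _∷_)
open import Data.List.Relation.Unary.Linked.Properties
  using (Linked⇒AllPairs; AllPairs⇒Linked)
open import Data.List.Relation.Unary.Unique.DecPropositional.Properties
  using (deduplicate-!)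
open import Data.List.Relation.Unary.Unique.Propositional using (Unique)
import Data.List.Relation.Unary.Unique.Propositional.Properties as Unique
open import Data.Maybe.Properties using (just-injective)
open import Data.Nat.Base
  using (ℕ; zero; suc; _+_; _∸_; _≤_; _<_; z≤n; s≤s; z<s; s<s)
open import Data.Nat.ListAction using (sum)
open import Data.Nat.Properties
open import Data.Product.Base using (_×_; ∃-syntax; _,_; proj₁; proj₂; map₁)
open import Data.Sum.Base using (_⊎_; inj₁; inj₂)
open import Function.Base using (_∘_; id)
open import Function.Bundles using (_⇔_; mk⇔; Equivalence)
open import Function.Construct.Composition using (_⇔-∘_)
open import Relation.Binary.Definitions using (DecidableEquality)
open import Relation.Binary.PropositionalEquality
  using (_≡_; _≢_; refl; sym; trans; cong; cong₂; subst; setoid)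
open import Relation.Nullary using (Dec; yes; no; ¬_; contradiction)
open import Data.List.Relation.Binary.Permutation.Setoid.Properties (setoid ℕ)
  using (Unique-resp-↭)

open Equivalence using (to; from)

private variable
  A B C : Set

-- Counting

hasCount-cong : {P Q : A → Set} → (∀ x → P x ⇔ Q x) → ∀ {k} → HasCount P k → HasCount Q k
hasCount-cong P⇔Q (xs , xs! , xs⇔P , eq) = xs , xs! , (λ x → P⇔Q x ⇔-∘ xs⇔P x) , eq

hasCount-⊎ : {P Q : A → Set} → (∀ {x} → P x → Q x → ⊥) → ∀ {j k} →
             HasCount P j → HasCount Q k → HasCount (λ x → P x ⊎ Q x) (j + k)
hasCount-⊎ {P = P} {Q} disjoint (xs , xs! , xs⇔P , refl) (ys , ys! , ys⇔Q , refl) =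
  xs ++ ys , Unique.++⁺ xs! ys! (λ (i , j) → disjoint (to (xs⇔P _) i) (to (ys⇔Q _) j)) ,
  (λ x → mk⇔ (split ∘ ∈-++⁻ xs) join) , length-++ xs
  where
  split : ∀ {x} → x ∈ xs ⊎ x ∈ ys → P x ⊎ Q x
  split (inj₁ i) = inj₁ (to (xs⇔P _) i)
  split (inj₂ j) = inj₂ (to (ys⇔Q _) j)
  join : ∀ {x} → P x ⊎ Q x → x ∈ xs ++ ys
  join (inj₁ p) = ∈-++⁺ˡ (from (xs⇔P _) p)
  join (inj₂ q) = ∈-++⁺ʳ xs (from (ys⇔Q _) q)

-- A relation replaces a function because the image of `a` is available only under `P a`.
-- `functional` shows that the images chosen along `xs` exhaust `Q`, and `injective` that they are
-- distinct. Each is asked for only within `Q` or `P`: an insertion is determined only once the type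
-- is fixed.
hasCount-bijection :
  {P : A → Set} {Q : B → Set} (R : A → B → Set) →
  (∀ {a} → P a → ∃[ b ] Q b × R a b) →
  (∀ {b} → Q b → ∃[ a ] P a × R a b) →
  (∀ {a b b′} → Q b → Q b′ → R a b → R a b′ → b ≡ b′) →
  (∀ {a a′ b} → P a → P a′ → R a b → R a′ b → a ≡ a′) →
  ∀ {k} → HasCount P k → HasCount Q k
hasCount-bijection {A = A} {B = B} {P} {Q} R total onto functional injective (xs , xs! , xs⇔P , refl) =
  let ys , xs~ys = images xs (All.tabulate (to (xs⇔P _))) in
  ys , unique xs~ys xs! , (λ b → mk⇔ (sound xs~ys) (complete xs~ys)) , lengths xs~ys
  where
  S : A → B → Set
  S a b = P a × Q b × R a b

  images : ∀ xs → All P xs → ∃[ ys ] Pointwise S xs ys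
  images []       []       = [] , []
  images (x ∷ xs) (p ∷ ps) =
    let y , q , r = total p
        ys , xs~ys = images xs ps
    in y ∷ ys , (p , q , r) ∷ xs~ys

  lengths : ∀ {xs ys} → Pointwise S xs ys → length ys ≡ length xs
  lengths []       = refl
  lengths (_ ∷ ss) = cong suc (lengths ss)

  sound : ∀ {xs ys b} → Pointwise S xs ys → b ∈ ys → Q b
  sound ((_ , q , _) ∷ _) (here refl) = q
  sound (_ ∷ ss)          (there j)   = sound ss j

  image∈ : ∀ {xs ys a} → Pointwise S xs ys → a ∈ xs → ∃[ b ] b ∈ ys × S a b
  image∈ (s ∷ _)  (here refl) = _ , here refl , s
  image∈ (_ ∷ ss) (there i)   = let b , j , s = image∈ ss i in b , there j , s

  complete : ∀ {ys b} → Pointwise S xs ys → Q b → b ∈ ys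
  complete ss q =
    let a , p , r = onto q
        b , j , (_ , q′ , r′) = image∈ ss (from (xs⇔P a) p)
    in subst (_∈ _) (functional q′ q r′ r) j

  fresh : ∀ {xs ys a b} → S a b → Pointwise S xs ys → All (a ≢_) xs → All (b ≢_) ys
  fresh _ []       []       = []
  fresh s@(p , q , r) ((p′ , q′ , r′) ∷ ss) (a≢a′ ∷ a∉) =
    (λ { refl → a≢a′ (injective p p′ r r′) }) ∷ fresh s ss a∉

  unique : ∀ {xs ys} → Pointwise S xs ys → Unique xs → Unique ys
  unique []       []        = []
  unique (s ∷ ss) (a∉ ∷ us) = fresh s ss a∉ ∷ unique ss us

-- The common value stays existential: the induction builds both enumerations side by side and never
-- needs a formula for it.
SameCount : (A → Set) → (B → Set) → Set
SameCount P Q = ∃[ t ] (HasCount P t × HasCount Q t)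

sameCount-cong : {P P′ : A → Set} {Q Q′ : B → Set} →
                 (∀ a → P a ⇔ P′ a) → (∀ b → Q b ⇔ Q′ b) → SameCount P Q → SameCount P′ Q′
sameCount-cong P⇔ Q⇔ (t , p , q) = t , hasCount-cong P⇔ p , hasCount-cong Q⇔ q

-- Each element belongs to the class of at most one `c`, so the union over distinct `c` is disjoint
-- and both counts are sums over `cs`, equal term by term.
sameCount-⋃ : (P : C → A → Set) (Q : C → B → Set) →
              (∀ {c c′ a} → P c a → P c′ a → c ≡ c′) →
              (∀ {c c′ b} → Q c b → Q c′ b → c ≡ c′) →
              ∀ {cs} → Unique cs → All (λ c → SameCount (P c) (Q c)) cs →
              SameCount (λ a → Any (λ c → P c a) cs) (λ b → Any (λ c → Q c b) cs)
sameCount-⋃ P Q P! Q! [] [] =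
  0 , ([] , [] , (λ _ → mk⇔ (λ ()) (λ ())) , refl) , ([] , [] , (λ _ → mk⇔ (λ ()) (λ ())) , refl)
sameCount-⋃ P Q P! Q! (c∉ ∷ cs!) ((j , p , q) ∷ pqs) =
  let k , ps , qs = sameCount-⋃ P Q P! Q! cs! pqs in
  j + k ,
  hasCount-cong (λ _ → mk⇔ Any.fromSum Any.toSum) (hasCount-⊎ (disjoint P P! c∉) p ps) ,
  hasCount-cong (λ _ → mk⇔ Any.fromSum Any.toSum) (hasCount-⊎ (disjoint Q Q! c∉) q qs)
  where
  disjoint : (R : C → A → Set) → (∀ {c c′ a} → R c a → R c′ a → c ≡ c′) →
             ∀ {c cs a} → All (c ≢_) cs → R c a → Any (λ c → R c a) cs → ⊥
  disjoint R R! c∉ r rs = let c , i , r′ = find rs in All.lookup c∉ i (R! r r′)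

-- Cover relations

-- lower unifies decrease and decreaseLast; drop is deleteLast, join is merge.
data Move : List ℕ → List ℕ → Set where
  lower : ∀ {a s} → Move (suc (suc a) ∷ s) (suc a ∷ s)
  drop  : ∀ {a} → Move (a ∷ 1 ∷ []) (a ∷ [])
  join  : ∀ {a b c s} → c ≡ a + suc b → Move (a ∷ suc (suc b) ∷ s) (c ∷ s)
  skip  : ∀ {a s s′} → Move s s′ → Move (a ∷ s) (a ∷ s′)

move⇒⋖ : ∀ {s s′} → Move s s′ → s ⋖ s′
move⇒⋖ {s = _ ∷ []}    lower = decreaseLast [] _ (s<s z<s) refl refl
move⇒⋖ {s = _ ∷ _ ∷ _} lower = decrease [] _ _ _ (s<s z<s) refl refl
move⇒⋖ drop = deleteLast (λ ()) refl
move⇒⋖ (join {a} {b} {s = s} refl) =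
  merge [] _ _ _ (s<s z<s) refl (cong (_∷ s) (sym (cong (_∸ 1) (+-suc a (suc b)))))
move⇒⋖ (skip m) with move⇒⋖ m
... | decrease xs a y ys 1<a refl refl = decrease (_ ∷ xs) a y ys 1<a refl refl
... | decreaseLast xs a 1<a refl refl  = decreaseLast (_ ∷ xs) a 1<a refl refl
... | deleteLast _ refl                = deleteLast (λ ()) refl
... | merge xs a b ys 2≤b refl refl    = merge (_ ∷ xs) a b ys 2≤b refl refl

prefix : ∀ xs {s s′} → Move s s′ → Move (xs ++ s) (xs ++ s′)
prefix []       m = m
prefix (_ ∷ xs) m = skip (prefix xs m)

⋖⇒move : ∀ {s s′} → s ⋖ s′ → Move s s′
⋖⇒move (decrease xs _ _ _ (s≤s (s≤s z≤n)) refl refl) = prefix xs lower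
⋖⇒move (decreaseLast xs _ (s≤s (s≤s z≤n)) refl refl) = prefix xs lower
⋖⇒move {s′ = s′} (deleteLast s′≢[] refl) = dropLast s′ s′≢[]
  where
  dropLast : ∀ s → s ≢ [] → Move (s ∷ʳ 1) s
  dropLast []          s≢[] = contradiction refl s≢[]
  dropLast (_ ∷ [])    _    = drop
  dropLast (_ ∷ x ∷ s) _    = skip (dropLast (x ∷ s) λ ())
⋖⇒move (merge xs a (suc (suc b)) ys (s≤s (s≤s z≤n)) refl refl) =
  prefix xs (join (cong (_∸ 1) (+-suc a (suc b))))

-- Enumeration of the covers

lowerings : ℕ → List ℕ → List (List ℕ)
lowerings (suc (suc a)) s = [ suc a ∷ s ]
lowerings _             _ = []

joins : ℕ → List ℕ → List (List ℕ)
joins a (1 ∷ [])          = [ a ∷ [] ]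
joins a (suc (suc b) ∷ s) = [ a + suc b ∷ s ]
joins _ _                 = []

covers : List ℕ → List (List ℕ)
covers []      = []
covers (a ∷ s) = lowerings a s ++ joins a s ++ map (a ∷_) (covers s)

covers-complete : ∀ {s s′} → Move s s′ → s′ ∈ covers s
covers-complete lower       = here refl
covers-complete {a ∷ _} drop        = ∈-++⁺ʳ (lowerings a _) (here refl)
covers-complete {a ∷ _} (join refl) = ∈-++⁺ʳ (lowerings a _) (here refl)
covers-complete {a ∷ s} (skip m)    =
  ∈-++⁺ʳ (lowerings a s) (∈-++⁺ʳ (joins a s) (∈-map⁺ (a ∷_) (covers-complete m)))

covers-sound : ∀ s {s′} → s′ ∈ covers s → Move s s′
covers-sound (a ∷ s) i with ∈-++⁻ (lowerings a s) i
... | inj₁ j = lowering a j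
  where
  lowering : ∀ a {s′} → s′ ∈ lowerings a s → Move (a ∷ s) s′
  lowering (suc (suc a)) (here refl) = lower
... | inj₂ j with ∈-++⁻ (joins a s) j
...   | inj₁ k = joining s k
  where
  joining : ∀ s {s′} → s′ ∈ joins a s → Move (a ∷ s) s′
  joining (1 ∷ [])          (here refl) = drop
  joining (suc (suc b) ∷ s) (here refl) = join refl
...   | inj₂ k with ∈-map⁻ (a ∷_) k
...     | _ , l , refl = skip (covers-sound s l)

-- `deduplicate` removes repetitions without a comparison of covers produced by different rules.
distinctCovers : ∀ s → ∃[ cs ] Unique cs × (∀ {s′} → s′ ∈ cs ⇔ Move s s′)
distinctCovers s =
  deduplicate _≟s_ (covers s) , deduplicate-! _≟s_ (covers s) ,
  mk⇔ (covers-sound s ∘ ∈-deduplicate⁻ _≟s_ (covers s)) (∈-deduplicate⁺ _≟s_ ∘ covers-complete)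
  where
  _≟s_ : DecidableEquality (List ℕ)
  _≟s_ = ≡-dec _≟_

-- Makes the sum the measure of the induction; it falls by one just as the ground set loses one
-- element.
sum-move : ∀ {s s′} → Move s s′ → sum s ≡ suc (sum s′)
sum-move lower = refl
sum-move (drop {a}) = +-suc a 0
sum-move (join {a} {b} {s = s} refl) =
  trans (+-suc a (suc b + sum s)) (cong suc (sym (+-assoc a (suc b) (sum s))))
sum-move (skip {a} m) = trans (cong (a +_) (sum-move m)) (+-suc a _)

positive-move : ∀ {s s′} → Move s s′ → All (0 <_) s → All (0 <_) s′
positive-move lower                 (_ ∷ ps)     = z<s ∷ ps
positive-move drop                  (p ∷ _)      = p ∷ []
positive-move (join {a} {b} refl)   (_ ∷ _ ∷ ps) = subst (0 <_) (sym (+-suc a b)) z<s ∷ ps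
positive-move (skip m)              (p ∷ ps)     = p ∷ positive-move m ps

move≢[] : ∀ {s s′} → Move s s′ → s′ ≢ []
move≢[] lower    ()
move≢[] drop     ()
move≢[] (join _) ()
move≢[] (skip _) ()

-- Paths

PathVia : List ℕ → List ℕ → List (List ℕ) → Set
PathVia s s′ ps = ∃[ qs ] IsPath s′ qs × ps ≡ s ∷ qs

hasCount-via : ∀ {s s′ k} → HasCount (IsPath s′) k → HasCount (PathVia s s′) k
hasCount-via {s} = hasCount-bijection (λ qs ps → ps ≡ s ∷ qs)
  (λ {qs} path → s ∷ qs , (qs , path , refl) , refl) id
  (λ { _ _ refl refl → refl }) (λ { _ _ refl refl → refl })

pathVia-functional : ∀ {s s′ s″ ps} → PathVia s s′ ps → PathVia s s″ ps → s′ ≡ s″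
pathVia-functional (_ , path , refl) (_ , path′ , refl) =
  just-injective (trans (sym (IsPath.starts path)) (IsPath.starts path′))

-- As `s` is not `[ 1 ]`, no path from it stops at once, so each has a second vertex, which is a
-- cover of `s`.
isPath⇔ : ∀ {s} cs → (∀ {s′} → s′ ∈ cs ⇔ Move s s′) → s ≢ [ 1 ] → ∀ ps →
          Any (λ s′ → PathVia s s′ ps) cs ⇔ IsPath s ps
isPath⇔ {s} cs cs⇔ s≢1 ps = mk⇔ build (uncons ps)
  where
  build : Any (λ s′ → PathVia s s′ ps) cs → IsPath s ps
  build any with find any
  ... | s′ , i , s′ ∷ _ , record { starts = refl ; ends = ends ; steps = steps } , refl =
    record { starts = refl ; ends = ends ; steps = move⇒⋖ (to cs⇔ i) ∷ steps }
  uncons : ∀ ps → IsPath s ps → Any (λ s′ → PathVia s s′ ps) cs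
  uncons (_ ∷ []) path =
    contradiction (just-injective (trans (sym (IsPath.starts path)) (IsPath.ends path))) s≢1
  uncons (_ ∷ s′ ∷ _) record { starts = refl ; ends = ends ; steps = s⋖s′ ∷ steps } =
    lose (from cs⇔ (⋖⇒move s⋖s′))
         (_ , record { starts = refl ; ends = ends ; steps = steps } , refl)

isPath-[1]⇔ : ∀ ps → ps ∈ [ [ [ 1 ] ] ] ⇔ IsPath [ 1 ] ps
isPath-[1]⇔ ps = mk⇔
  (λ { (here refl) → record { starts = refl ; ends = refl ; steps = [-] } }) (trivial ps)
  where
  trivial : ∀ ps → IsPath [ 1 ] ps → ps ∈ [ [ [ 1 ] ] ]
  trivial (_ ∷ [])    path with refl ← IsPath.starts path = here refl
  -- The entry 1 cannot be lowered, and `drop` and `join` need two entries, so no step leaves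
  -- `[ 1 ]`.
  trivial (_ ∷ _ ∷ _) record { starts = refl ; steps = 1⋖s ∷ _ } with ⋖⇒move 1⋖s
  ... | skip ()

allPairs-++⁻ : ∀ {A : Set} {R : A → A → Set} xs {ys} → AllPairs R (xs ++ ys) →
               AllPairs R xs × AllPairs R ys × All (λ x → All (R x) ys) xs
allPairs-++⁻ []       rs       = [] , rs , []
allPairs-++⁻ (x ∷ xs) (r ∷ rs) =
  let rxs , rys , rxys = allPairs-++⁻ xs rs
  in All.++⁻ˡ xs r ∷ rxs , rys , All.++⁻ʳ xs r ∷ rxys

-- Blocks

Increasing : List⁺ ℕ → Set
Increasing b = AllPairs _<_ (toList b)

-- Equivalent to min c < max b, but visibly monotone in both blocks.
Cross : List⁺ ℕ → List⁺ ℕ → Set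
Cross b c = Any (λ p → Any (_< p) (toList c)) (toList b)

cross? : ∀ b c → Dec (Cross b c)
cross? b c = any? (λ p → any? (_<? p) (toList c)) (toList b)

min∈ : ∀ x xs → min (x ∷ xs) ∈ x ∷ xs
min∈ x []       = here refl
min∈ x (y ∷ ys) with ⊓-sel x (min (y ∷ ys))
... | inj₁ eq = here eq
... | inj₂ eq = there (subst (_∈ y ∷ ys) (sym eq) (min∈ y ys))

max∈ : ∀ x xs → max (x ∷ xs) ∈ x ∷ xs
max∈ x []       = here refl
max∈ x (y ∷ ys) with ⊔-sel x (max (y ∷ ys))
... | inj₁ eq = here eq
... | inj₂ eq = there (subst (_∈ y ∷ ys) (sym eq) (max∈ y ys))

min≤ : ∀ b {p} → p ∈ toList b → min b ≤ p
min≤ (x ∷ [])     (here refl) = ≤-refl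
min≤ (x ∷ y ∷ ys) (here refl) = m⊓n≤m x _
min≤ (x ∷ y ∷ ys) (there i)   = ≤-trans (m⊓n≤n x _) (min≤ (y ∷ ys) i)

≤max : ∀ b {p} → p ∈ toList b → p ≤ max b
≤max (x ∷ [])     (here refl) = ≤-refl
≤max (x ∷ y ∷ ys) (here refl) = m≤m⊔n x _
≤max (x ∷ y ∷ ys) (there i)   = ≤-trans (≤max (y ∷ ys) i) (m≤n⊔m x _)

min<max⇒cross : ∀ {b c} → min c < max b → Cross b c
min<max⇒cross {b ∷ bs} {c ∷ cs} lt = lose (max∈ b bs) (lose (min∈ c cs) lt)

cross⇒min<max : ∀ {b c} → Cross b c → min c < max b
cross⇒min<max {b} {c} cr with find cr
... | p , i , lts with find lts
...   | q , j , q<p = ≤-<-trans (min≤ c j) (<-≤-trans q<p (≤max b i))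

-- Without a crossing no element of `c` lies below one of `b`; disjointness makes the inequality
-- strict.
++-increasing : ∀ b c → Increasing b → Increasing c →
                (∀ {p} → p ∈ toList b → p ∉ toList c) →
                ¬ Cross b c → Increasing (b ⁺++⁺ c)
++-increasing b c b↑ c↑ disjoint ¬cr =
  AllPairs.++⁺ b↑ c↑ (All.tabulate λ i → All.tabulate λ j → less i j)
  where
  less : ∀ {p q} → p ∈ toList b → q ∈ toList c → p < q
  less i j = ≤∧≢⇒< (≮⇒≥ λ q<p → ¬cr (lose i (lose j q<p))) λ { refl → disjoint i j }

increasing⇒¬cross : ∀ b c → Increasing (b ⁺++⁺ c) → ¬ Cross b c
increasing⇒¬cross b c bc↑ cr =
  let _ , i , lts = find cr
      _ , j , q<p = find lts
      _ , _ , b<c = allPairs-++⁻ (toList b) bc↑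
  in <-asym q<p (All.lookup (All.lookup b<c i) j)

-- All of `b` lies below the head of `c`, so a crossing witnessed in `b` is also witnessed by that
-- head.
cross-++⁻ˡ : ∀ b c d → Increasing (b ⁺++⁺ c) → Cross (b ⁺++⁺ c) d → Cross c d
cross-++⁻ˡ b (z ∷ zs) d inc cr with Any.++⁻ (toList b) cr
... | inj₂ cr′ = cr′
... | inj₁ cr′ =
  let p , i , lt = find cr′
      _ , _ , lts = allPairs-++⁻ (toList b) inc
  in here (Any.map (λ q<p → <-trans q<p (All.head (All.lookup lts i))) lt)

-- The head of `b` is the least element of the concatenation, so whatever lies above some element
-- lies above that head.
cross-++⁻ʳ : ∀ a b c → Increasing (b ⁺++⁺ c) → Cross a (b ⁺++⁺ c) → Cross a b
cross-++⁻ʳ a (y ∷ ys) c (y< ∷ _) = Any.map belowHead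
  where
  belowHead : ∀ {p} → Any (_< p) (y ∷ ys ++ toList c) → Any (_< p) (y ∷ ys)
  belowHead (here y<p)  = here y<p
  belowHead (there lts) =
    let _ , i , q<p = find lts in here (<-trans (All.lookup y< i) q<p)

-- Inserting the smallest element

private variable
  x lo hi : ℕ
  b c d : List⁺ ℕ
  π π₁ π₂ π′ : List (List⁺ ℕ)

-- Insert x π′ π relates π′ to π along the cover relation type π ⋖ type π′:
-- insert⇒move and move⇒insert match the constructors with those of Move.
data Insert (x : ℕ) : List (List⁺ ℕ) → List (List⁺ ℕ) → Set where
  extend : Insert x (b ∷ π) ((x ∷⁺ b) ∷ π)
  append : Insert x (b ∷ []) (b ∷ List⁺.[ x ] ∷ [])
  split  : d ≡ b ⁺++⁺ c → Insert x (d ∷ π) (b ∷ (x ∷⁺ c) ∷ π)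
  there  : Insert x π′ π → Insert x (b ∷ π′) (b ∷ π)

type : List (List⁺ ℕ) → List ℕ
type = map List⁺.length

elements : List (List⁺ ℕ) → List ℕ
elements = concat ∘ map toList

length-⁺++⁺ : ∀ (b c : List⁺ ℕ) → List⁺.length (b ⁺++⁺ c) ≡ List⁺.length b + List⁺.length c
length-⁺++⁺ b c = length-++ (toList b)

insert⇒move : Insert x π′ π → Move (type π) (type π′)
insert⇒move extend                        = lower
insert⇒move append                        = drop
insert⇒move (split {b = b} {c = c} refl)  = join (length-⁺++⁺ b c)
insert⇒move (there ins)                   = skip (insert⇒move ins)

splitBlock : ∀ m n (d : List⁺ ℕ) → List⁺.length d ≡ suc m + suc n →
             ∃[ b ] ∃[ c ] d ≡ b ⁺++⁺ c × List⁺.length b ≡ suc m × List⁺.length c ≡ suc n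
splitBlock zero n (x ∷ y ∷ ys) eq = x ∷ [] , y ∷ ys , refl , refl , suc-injective eq
splitBlock (suc m) n (x ∷ y ∷ ys) eq =
  let b , c , eq₁ , eq₂ , eq₃ = splitBlock m n (y ∷ ys) (suc-injective eq)
  in x ∷⁺ b , c , cong (x ∷⁺_) eq₁ , cong suc eq₂ , eq₃

-- A merged entry forgets where its block is to be cut, but `s` records the two lengths. Positivity
-- keeps the first part nonempty; the second is nonempty since its entry in `s` is at least 2, and
-- only one element of that block is `x`.
move⇒insert : ∀ {s s′} → Move s s′ → All (0 <_) s → ∀ π′ → type π′ ≡ s′ →
              ∃[ π ] Insert x π′ π × type π ≡ s
move⇒insert lower _ (b ∷ π) refl = _ , extend , refl
move⇒insert drop _ (b ∷ []) refl = _ , append , refl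
move⇒insert (join {zero} _) (() ∷ _)
move⇒insert (join {suc a} {n} eq) _ (d ∷ π) refl =
  let b , c , d≡ , eq₁ , eq₂ = splitBlock a n d eq
  in _ , split d≡ , cong₂ (λ k l → k ∷ suc l ∷ type π) eq₁ eq₂
move⇒insert (skip m) (_ ∷ ps) (b ∷ π) refl =
  let _ , ins , eq = move⇒insert m ps π refl in _ , there ins , cong (_ ∷_) eq

elements-insert : Insert x π′ π → elements π ↭ x ∷ elements π′
elements-insert extend = ↭-refl
elements-insert {x} (append {b}) = shift x (toList b) []
elements-insert {x} (split {b = b} {c = c} {π = π} refl) =
  ↭-trans (shift x (toList b) (toList c ++ elements π))
          (prep x (↭-reflexive (sym (++-assoc (toList b) (toList c) (elements π)))))
elements-insert {x} (there {b = b} ins) =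
  ↭-trans (++⁺ˡ (toList b) (elements-insert ins)) (shift x (toList b) _)

++-injective : ∀ {A : Set} (xs xs′ : List A) {ys ys′} → length xs ≡ length xs′ →
               xs ++ ys ≡ xs′ ++ ys′ → xs ≡ xs′ × ys ≡ ys′
++-injective []       []         _  eq = refl , eq
++-injective (x ∷ xs) (x′ ∷ xs′) l≡ eq =
  let eq₁ , eq₂ = ++-injective xs xs′ (suc-injective l≡) (∷-injectiveʳ eq)
  in cong₂ _∷_ (∷-injectiveˡ eq) eq₁ , eq₂

toList-injective : ∀ {A : Set} {b c : List⁺ A} → toList b ≡ toList c → b ≡ c
toList-injective refl = refl

⁺++⁺-injective : ∀ (b b′ : List⁺ ℕ) {c c′} → List⁺.length b ≡ List⁺.length b′ →
                 b ⁺++⁺ c ≡ b′ ⁺++⁺ c′ → b ≡ b′ × c ≡ c′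
⁺++⁺-injective b b′ l≡ eq =
  let eq₁ , eq₂ = ++-injective (toList b) (toList b′) l≡ (cong toList eq)
  in toList-injective eq₁ , toList-injective eq₂

length-<-⁺++⁺ : ∀ (b c : List⁺ ℕ) → List⁺.length b < List⁺.length (b ⁺++⁺ c)
length-<-⁺++⁺ b c = subst (List⁺.length b <_) (sym (length-⁺++⁺ b c)) (m<m+n _ z<s)

-- The first entry of the new type, compared with the length of the first block of `π′`, tells the
-- constructors apart: larger for `extend`, smaller for `split`, equal for `append` and `there`.
-- Where `append` applies, `there` would have to insert into an empty list.
insert-functional : Insert x π′ π₁ → Insert x π′ π₂ → type π₁ ≡ type π₂ → π₁ ≡ π₂
insert-functional extend extend _ = refl
insert-functional extend append ()
insert-functional extend (split {b = b} {c = c} refl) eq =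
  contradiction (sym (∷-injectiveˡ eq)) (<⇒≢ (m<n⇒m<1+n (length-<-⁺++⁺ b c)))
insert-functional extend (there _) eq = contradiction (∷-injectiveˡ eq) 1+n≢n
insert-functional append extend ()
insert-functional append append _ = refl
insert-functional append (split {b = b} {c = c} refl) eq =
  contradiction (sym (∷-injectiveˡ eq)) (<⇒≢ (length-<-⁺++⁺ b c))
insert-functional append (there ()) _
insert-functional (split {b = b} {c = c} refl) extend eq =
  contradiction (∷-injectiveˡ eq) (<⇒≢ (m<n⇒m<1+n (length-<-⁺++⁺ b c)))
insert-functional (split {b = b} {c = c} refl) append eq =
  contradiction (∷-injectiveˡ eq) (<⇒≢ (length-<-⁺++⁺ b c))
-- Equal lengths of the first parts force the same cut.
insert-functional (split {b = b} refl) (split {b = b′} eq′) eq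
  with refl , refl ← ⁺++⁺-injective b b′ (∷-injectiveˡ eq) eq′ = refl
insert-functional (split {b = b} {c = c} refl) (there _) eq =
  contradiction (∷-injectiveˡ eq) (<⇒≢ (length-<-⁺++⁺ b c))
insert-functional (there _) extend eq = contradiction (sym (∷-injectiveˡ eq)) 1+n≢n
insert-functional (there ()) append _
insert-functional (there _) (split {b = b} {c = c} refl) eq =
  contradiction (sym (∷-injectiveˡ eq)) (<⇒≢ (length-<-⁺++⁺ b c))
insert-functional (there ins₁) (there ins₂) eq =
  cong (_ ∷_) (insert-functional ins₁ ins₂ (∷-injectiveʳ eq))

-- Insertion is injective and preserves validity

Valid : List (List⁺ ℕ) → Set
Valid π = All Increasing π × Linked Cross π

Above : ℕ → List (List⁺ ℕ) → Set
Above x = All (All (x <_) ∘ toList)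

-- All elements of `π′` lie above `x`, so a first block that starts with `x` is new, and only
-- `extend` creates one.
insert-at-head : Above x π′ → Insert x π′ ((x ∷⁺ b) ∷ π) → π′ ≡ b ∷ π
insert-at-head _         extend       = refl
insert-at-head ((x<x ∷ _) ∷ _) append       = contradiction x<x (<-irrefl refl)
insert-at-head ((x<x ∷ _) ∷ _) (split refl) = contradiction x<x (<-irrefl refl)
insert-at-head ((x<x ∷ _) ∷ _) (there _)    = contradiction x<x (<-irrefl refl)

-- The one ambiguity is a block `b` followed by `x ∷⁺ c`: it may come from `b ⁺++⁺ c` or from `b`
-- and `c` side by side. The former needs an increasing concatenation, the latter a crossing of `b`
-- and `c`, and these exclude each other.
insert-injective : Above x π₁ → Above x π₂ → Valid π₁ → Valid π₂ →
                   Insert x π₁ π → Insert x π₂ π → π₁ ≡ π₂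
insert-injective _  a₂ _ _ extend ins₂   = sym (insert-at-head a₂ ins₂)
insert-injective a₁ _  _ _ ins₁   extend = insert-at-head a₁ ins₁
insert-injective _ _ _ _ append append = refl
insert-injective _ _ _ _ append (there (there ()))
insert-injective _ _ _ _ (there (there ())) append
insert-injective _ _ _ _ (split refl) (split refl) = refl
insert-injective _ a₂ (bc↑ ∷ _ , _) (_ , cr) (split {b = b} {c = c} refl) (there ins₂)
  with refl ← insert-at-head (All.tail a₂) ins₂ =
  contradiction (Linked.head cr) (increasing⇒¬cross b c bc↑)
insert-injective a₁ _ (_ , cr) (bc↑ ∷ _ , _) (there ins₁) (split {b = b} {c = c} refl)
  with refl ← insert-at-head (All.tail a₁) ins₁ =
  contradiction (Linked.head cr) (increasing⇒¬cross b c bc↑)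
insert-injective a₁ a₂ (_ ∷ i₁ , l₁) (_ ∷ i₂ , l₂) (there {b = b} ins₁) (there ins₂) =
  cong (b ∷_) (insert-injective (All.tail a₁) (All.tail a₂)
                 (i₁ , Linked.tail l₁) (i₂ , Linked.tail l₂) ins₁ ins₂)

-- The first block gains `x`, stays as it is, or is cut down to an initial part that retains its
-- least element.
crossHead-insert : ∀ a → Insert x (c ∷ π′) (b ∷ π) → Increasing c → Cross a c → Cross a b
crossHead-insert a extend       _  = Any.map there
crossHead-insert a append       _  = id
crossHead-insert a (split {b = b} {c = c} refl) c↑ = cross-++⁻ʳ a b c c↑
crossHead-insert a (there _)    _  = id

insert-increasing : Above x π′ → All Increasing π′ → Insert x π′ π → All Increasing π
insert-increasing (x<b ∷ _) (b↑ ∷ π↑) extend = (x<b ∷ b↑) ∷ π↑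
insert-increasing _ (b↑ ∷ []) append = b↑ ∷ ([] ∷ []) ∷ []
insert-increasing (x<bc ∷ _) (bc↑ ∷ π↑) (split {b = b} {c = c} refl) =
  let b↑ , c↑ , _ = allPairs-++⁻ (toList b) bc↑
  in b↑ ∷ (All.++⁻ʳ (toList b) x<bc ∷ c↑) ∷ π↑
insert-increasing (_ ∷ x<π) (b↑ ∷ π↑) (there ins) = b↑ ∷ insert-increasing x<π π↑ ins

-- In `append` and `split`, `x` lies below the whole block before it, so this pair crosses. A block
-- cut by `split` hands its upper part to `c`, which therefore still crosses the next block.
insert-crossing : Above x π′ → All Increasing π′ → Linked Cross π′ →
                  Insert x π′ π → Linked Cross π
insert-crossing a _ [-]      extend = [-]
insert-crossing a _ (r ∷ rs) extend = there r ∷ rs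
insert-crossing ((x<b ∷ _) ∷ _) _ _ append = here (here x<b) ∷ [-]
insert-crossing ((x<b ∷ _) ∷ _) _ [-] (split refl) = here (here x<b) ∷ [-]
insert-crossing ((x<b ∷ _) ∷ _) (bc↑ ∷ _) (r ∷ rs) (split {b = b} {c = c} {π = d ∷ _} refl) =
  here (here x<b) ∷ there (cross-++⁻ˡ b c d bc↑ r) ∷ rs
insert-crossing a (_ ∷ c↑ ∷ π↑) (r ∷ rs) (there {π = _ ∷ _} {b = b} ins) =
  crossHead-insert b ins c↑ r ∷ insert-crossing (All.tail a) (c↑ ∷ π↑) rs ins
insert-crossing a _ _ (there {π = []} ())

insert-valid : Above x π′ → Valid π′ → Insert x π′ π → Valid π
insert-valid a (π↑ , cr) ins = insert-increasing a π↑ ins , insert-crossing a π↑ cr ins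

-- Removing the smallest element

none-below : ∀ {ps} → All (x ≤_) ps → ¬ Any (_< x) ps
none-below x≤ lts = let _ , i , q<x = find lts in ≤⇒≯ (All.lookup x≤ i) q<x

cross-remove : ∀ b c → All (x ≤_) (toList c) → Cross (x ∷⁺ b) c → Cross b c
cross-remove b c x≤c (here lts) = contradiction lts (none-below x≤c)
cross-remove b c x≤c (there r)  = r

least∈ : ∀ y ys → All (x ≤_) (y ∷ ys) → AllPairs _<_ (y ∷ ys) → x ∈ y ∷ ys → x ≡ y
least∈ y ys _         _        (here eq) = eq
least∈ y ys (x≤y ∷ _) (y< ∷ _) (there i) = contradiction (All.lookup y< i) (≤⇒≯ x≤y)

-- Induction on the blocks until the one containing `x` is first. The first alternative, a lone
-- block `x`, leaves nothing after removal; met as the tail of a longer list, it becomes `append`.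
remove : ∀ π → All (x ≤_) (elements π) → Unique (elements π) → Valid π → x ∈ elements π →
         π ≡ [ List⁺.[ x ] ] ⊎ ∃[ π′ ] Insert x π′ π × Valid π′
remove (b ∷ π) _ _ _ i with Any.++⁻ (toList b) i
remove ((y ∷ ys) ∷ π) x≤ _ (b↑ ∷ π↑ , cr) _ | inj₁ i
  with refl ← least∈ y ys (All.++⁻ˡ (y ∷ ys) x≤) b↑ i = atHead ys x≤ b↑ cr
  where
  atHead : ∀ ys → All (y ≤_) (y ∷ ys ++ elements π) → Increasing (y ∷ ys) →
           Linked Cross ((y ∷ ys) ∷ π) →
           (y ∷ ys) ∷ π ≡ [ List⁺.[ y ] ] ⊎ ∃[ π′ ] Insert y π′ ((y ∷ ys) ∷ π) × Valid π′
  atHead []       _  _        [-]      = inj₁ refl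
  -- A lone `y` before a further block would have to exceed an element of it, yet `y` is least.
  atHead []       x≤ _        (_∷_ {y = c} (here lts) _) =
    contradiction lts (none-below (All.++⁻ˡ (toList c) (All.tail x≤)))
  atHead (z ∷ zs) _ (_ ∷ b↑) [-]      = inj₂ (_ , extend , b↑ ∷ π↑ , [-])
  atHead (z ∷ zs) x≤ (_ ∷ b↑) (_∷_ {y = c} r rs) =
    inj₂ (_ , extend , b↑ ∷ π↑ ,
      cross-remove (z ∷ zs) c (All.++⁻ˡ (toList c) (All.++⁻ʳ (y ∷ z ∷ zs) x≤)) r ∷ rs)
remove (b ∷ π) x≤ u (b↑ ∷ π↑ , cr) _ | inj₂ i
  with allPairs-++⁻ (toList b) u
... | _ , uπ , b≢π
  with remove π (All.++⁻ʳ (toList b) x≤) uπ (π↑ , Linked.tail cr) i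
... | inj₁ refl = inj₂ (_ , append , b↑ ∷ [] , [-])
-- The block of `x` starts the tail. Its crossing with `b` may have relied on `x` alone, so it is
-- tested again for the remainder `c`.
remove (b ∷ π) _ _ (b↑ ∷ _ , r ∷ _) _ | inj₂ _ | _ , _ , b≢π
  | inj₂ (_ , extend {b = c} {π = ρ} , c↑ ∷ ρ↑ , crρ)
  with cross? b c
... | yes r′ = inj₂ (_ , there extend , b↑ ∷ c↑ ∷ ρ↑ , r′ ∷ crρ)
... | no ¬r  =
  inj₂ (_ , split refl , ++-increasing b c b↑ c↑ disjoint ¬r ∷ ρ↑ , merged crρ)
  where
  disjoint : ∀ {p} → p ∈ toList b → p ∉ toList c
  disjoint i j = All.lookup (All.lookup b≢π i) (there (∈-++⁺ˡ j)) refl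
  merged : ∀ {ρ} → Linked Cross (c ∷ ρ) → Linked Cross ((b ⁺++⁺ c) ∷ ρ)
  merged [-]      = [-]
  merged (s ∷ ss) = Any.++⁺ʳ (toList b) s ∷ ss
remove (b ∷ π) _ _ (b↑ ∷ _ , r ∷ _) _ | inj₂ _ | _
  | inj₂ (_ , append , ρ↑ , crρ) =
  inj₂ (_ , there append , b↑ ∷ ρ↑ , r ∷ crρ)
-- The rejoined block contains the old first block of the tail, so `b` still crosses it.
remove (b ∷ π) _ _ (b↑ ∷ _ , r ∷ _) _ | inj₂ _ | _
  | inj₂ (_ , split refl , ρ↑ , crρ) =
  inj₂ (_ , there (split refl) , b↑ ∷ ρ↑ , Any.map Any.++⁺ˡ r ∷ crρ)
remove (b ∷ π) _ _ (b↑ ∷ _ , r ∷ _) _ | inj₂ _ | _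
  | inj₂ (_ , there ins , ρ↑ , crρ) =
  inj₂ (_ , there (there ins) , b↑ ∷ ρ↑ , r ∷ crρ)

-- Crossing partitions of intervals

Interval : ℕ → ℕ → List ℕ → Set
Interval lo hi ps = Unique ps × (∀ p → p ∈ ps ⇔ (lo < p × p ≤ hi))

interval-tail : ∀ {ps qs} → ps ↭ suc lo ∷ qs → Interval lo hi ps → Interval (suc lo) hi qs
interval-tail {lo} {hi} {ps} {qs} ps↭ (ps! , ps⇔) with Unique-resp-↭ (↭⇒↭ₛ ps↭) ps!
... | lo∉ ∷ qs! = qs! , λ p → mk⇔ (bounds p) (member p)
  where
  bounds : ∀ p → p ∈ qs → suc lo < p × p ≤ hi
  bounds p i = let lo<p , p≤hi = to (ps⇔ p) (∈-resp-↭ (↭-sym ps↭) (there i))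
               in ≤∧≢⇒< lo<p (All.lookup lo∉ i) , p≤hi
  member : ∀ p → suc lo < p × p ≤ hi → p ∈ qs
  member p (lo<p , p≤hi) with ∈-resp-↭ ps↭ (from (ps⇔ p) (<-trans (n<1+n lo) lo<p , p≤hi))
  ... | here refl = contradiction lo<p (<-irrefl refl)
  ... | there i   = i

interval-cons : ∀ {ps qs} → lo < hi → ps ↭ suc lo ∷ qs → Interval (suc lo) hi qs → Interval lo hi ps
interval-cons {lo} {hi} {ps} {qs} lo<hi ps↭ (qs! , qs⇔) =
  Unique-resp-↭ (↭⇒↭ₛ (↭-sym ps↭)) (All.tabulate (λ i → <⇒≢ (proj₁ (to (qs⇔ _) i))) ∷ qs!) ,
  λ p → mk⇔ (bounds p) (member p)
  where
  bounds : ∀ p → p ∈ ps → lo < p × p ≤ hi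
  bounds p i with ∈-resp-↭ ps↭ i
  ... | here refl = n<1+n lo , lo<hi
  ... | there j   = map₁ (<-trans (n<1+n lo)) (to (qs⇔ p) j)
  member : ∀ p → lo < p × p ≤ hi → p ∈ ps
  member p (lo<p , p≤hi) with m≤n⇒m<n∨m≡n lo<p
  ... | inj₁ lt   = ∈-resp-↭ (↭-sym ps↭) (there (from (qs⇔ p) (lt , p≤hi)))
  ... | inj₂ refl = ∈-resp-↭ (↭-sym ps↭) (here refl)

-- The ground set is {lo + 1, …, hi}, so that removing its least element needs
-- no relabelling.
record CrossingPartition (lo hi : ℕ) (s : List ℕ) (π : List (List⁺ ℕ)) : Set where
  constructor crossingPartition
  field
    valid    : Valid π
    interval : Interval lo hi (elements π)
    hasType  : type π ≡ s

  above : Above lo π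
  above = All.map⁻ (All.concat⁻ (All.tabulate (proj₁ ∘ to (proj₂ interval _))))

open CrossingPartition

-- With `lo` equal to 0 the bounds agree definitionally; transitivity of `_<_` turns neighbouring
-- comparisons into pairwise ones.
crossingPartition⇔ : ∀ {n s} π → CrossingPartition 0 n s π ⇔ (IsCrossingPartition n π × HasType s π)
crossingPartition⇔ π = mk⇔
  (λ { (crossingPartition (π↑ , cr) (π! , π⇔) refl) →
       record { increasing = All.map AllPairs⇒Linked π↑ ; covers = π⇔ ; once = π!
              ; crossing = Linked.map (λ {b} {c} → cross⇒min<max {b} {c}) cr } , refl })
  (λ { (record { increasing = π↑ ; covers = π⇔ ; once = π! ; crossing = cr } , refl) →
       crossingPartition (All.map (Linked⇒AllPairs <-trans) π↑ ,
         Linked.map (λ {b} {c} → min<max⇒cross {b} {c}) cr) (π! , π⇔) refl })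

-- The recurrence and the equality of the counts

InsertionInto : ℕ → ℕ → List ℕ → List ℕ → List (List⁺ ℕ) → Set
InsertionInto lo hi s s′ π =
  type π ≡ s × ∃[ π′ ] CrossingPartition (suc lo) hi s′ π′ × Insert (suc lo) π′ π

-- By injectivity of insertion `π` has at most one preimage, so it is counted under at most one
-- cover.
insertion-functional : ∀ {s s′ s″} →
  InsertionInto lo hi s s′ π → InsertionInto lo hi s s″ π → s′ ≡ s″
insertion-functional (_ , _ , cp , ins) (_ , _ , cp′ , ins′)
  with refl ← insert-injective (above cp) (above cp′) (valid cp) (valid cp′) ins ins′ =
  trans (sym (hasType cp)) (hasType cp′)

-- The move supplies an insertion for each partition of type `s′`; the prescribed type `s` makes it
-- unique.
hasCount-insertion : ∀ {s s′ k} → Move s s′ → All (0 <_) s →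
  HasCount (CrossingPartition (suc lo) hi s′) k → HasCount (InsertionInto lo hi s s′) k
hasCount-insertion {lo} m ps = hasCount-bijection (Insert (suc lo))
  (λ {π′} cp → let _ , ins , eq = move⇒insert m ps π′ (hasType cp)
               in _ , (eq , _ , cp , ins) , ins)
  proj₂
  (λ (eq , _) (eq′ , _) ins ins′ → insert-functional ins ins′ (trans eq (sym eq′)))
  (λ cp cp′ → insert-injective (above cp) (above cp′) (valid cp) (valid cp′))

-- `remove` yields no smaller partition only for a lone block of type `[ 1 ]`, which `s≢1` excludes.
insertion⇔ : ∀ {s} cs → (∀ {s′} → s′ ∈ cs ⇔ Move s s′) → s ≢ [ 1 ] → lo < hi → ∀ π →
             Any (λ s′ → InsertionInto lo hi s s′ π) cs ⇔ CrossingPartition lo hi s π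
insertion⇔ {lo} {hi} {s} cs cs⇔ s≢1 lo<hi π = mk⇔ build decompose
  where
  build : Any (λ s′ → InsertionInto lo hi s s′ π) cs → CrossingPartition lo hi s π
  build any =
    let _ , _ , eq , _ , cp , ins = find any
    in crossingPartition (insert-valid (above cp) (valid cp) ins)
         (interval-cons lo<hi (elements-insert ins) (interval cp)) eq
  decompose : CrossingPartition lo hi s π → Any (λ s′ → InsertionInto lo hi s s′ π) cs
  decompose cp@(crossingPartition v int@(π! , π⇔) refl)
    with remove π (All.tabulate (proj₁ ∘ to (π⇔ _))) π! v (from (π⇔ (suc lo)) (n<1+n lo , lo<hi))
  ... | inj₁ refl = contradiction refl s≢1
  ... | inj₂ (_ , ins , v′) =
    lose (from cs⇔ (insert⇒move ins))
         (refl , _ , crossingPartition v′ (interval-tail (elements-insert ins) int) refl , ins)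

singleton⇔ : ∀ π → π ∈ [ [ List⁺.[ suc lo ] ] ] ⇔ CrossingPartition lo (suc lo) [ 1 ] π
singleton⇔ {lo} π = mk⇔ build (unique π)
  where
  build : π ∈ [ [ List⁺.[ suc lo ] ] ] → CrossingPartition lo (suc lo) [ 1 ] π
  build (here refl) = crossingPartition (([] ∷ []) ∷ [] , [-])
    ([] ∷ [] , λ p → mk⇔ (λ { (here refl) → ≤-refl , ≤-refl })
                         (λ (lo<p , p≤) → here (≤-antisym p≤ lo<p))) refl
  unique : ∀ π → CrossingPartition lo (suc lo) [ 1 ] π → π ∈ [ [ List⁺.[ suc lo ] ] ]
  -- The omitted shapes contradict `hasType` by unification.
  unique ((y ∷ []) ∷ []) cp =
    let lo<y , y≤ = to (proj₂ (interval cp) y) (here refl)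
    in here (cong (λ p → [ List⁺.[ p ] ]) (≤-antisym y≤ lo<y))

-- Induction on the sum with `hi` fixed: removal of the least element replaces `lo` by `suc lo`, so
-- the claim is made for every `lo`.
sameCount : ∀ n {lo hi s} → s ≢ [] → All (0 <_) s → sum s ≡ n → lo + n ≡ hi →
            SameCount (CrossingPartition lo hi s) (IsPath s)
-- The empty sequence has one partition, the empty one, but no path.
sameCount n {s = []} s≢[] = contradiction refl s≢[]
sameCount zero {s = zero ∷ _}  _ (() ∷ _)
sameCount zero {s = suc _ ∷ _} _ _ ()
sameCount (suc n) {lo} {s = s} s≢[] ps eq refl with ≡-dec _≟_ s [ 1 ]
-- Here `n` is 0, so the upper bound becomes `suc lo` and each side has exactly one element.
... | yes refl rewrite sym eq | +-comm lo 1 =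
  1 , (_ , [] ∷ [] , singleton⇔ , refl) , (_ , [] ∷ [] , isPath-[1]⇔ , refl)
... | no s≢1 =
  let cs , cs! , cs⇔ = distinctCovers s in
  sameCount-cong (insertion⇔ cs cs⇔ s≢1 (m<m+n lo z<s)) (isPath⇔ cs cs⇔ s≢1)
    (sameCount-⋃ (InsertionInto lo (lo + suc n) s) (PathVia s)
      insertion-functional pathVia-functional cs! (All.tabulate (step ∘ to cs⇔)))
  where
  step : ∀ {s′} → Move s s′ → SameCount (InsertionInto lo (lo + suc n) s s′) (PathVia s s′)
  step m =
    let t , partitions , paths = sameCount n (move≢[] m) (positive-move m ps)
          (suc-injective (trans (sym (sum-move m)) eq)) (sym (+-suc lo n))
    in t , hasCount-insertion m ps partitions , hasCount-via paths

proposition2p14 : (s : List ℕ) → s ≢ [] → All (0 <_) s →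
    ∃[ t ] (IsT s t × HasCount (IsPath s) t)
proposition2p14 s s≢[] ps =
  sameCount-cong crossingPartition⇔ (λ _ → mk⇔ id id) (sameCount (sum s) s≢[] ps refl refl)
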